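{- For $1\le i<r$, \[ C_{i+1,r}(a)=C_{i,r}(a)+\sum_{k=r-i+1}^{r-1}C_{r-i+1,k}(a)\,C_{r-k,r-k}(a)-\sum_{k=i}^{r-1}C_{i,k}(a)\,C_{r-k,r-k}(a) \] as polynomials in $a$.
   Context: Bernoulli polynomials $B_n(a)$: $\sum_{n\ge0}B_n(a)x^n/n!=xe^{ax}/(e^x-1)$. For $1\le i\le r$, let $S_{i,r}$ be the set of $(n_1,\dots,n_r)\in\mathbb Z_{\ge0}^r$ with $n_1+\dots+n_r=r$, $n_1+\dots+n_j<j$ ($1\le j<i$), and $n_{j+1}+\dots+n_r\le r-j$ ($i\le j<r$), and set $C_{i,r}(a)=(-1)^r\sum_{(n_1,\dots,n_r)\in S_{i,r}}\prod_{j=1}^r\frac{B_{n_j}(a)}{n_j!}$. (These are the asymptotic coefficients at the origin of the Hurwitz multiple zeta function with all parameters equal to $a$.) -}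

module Defs where

open import Data.Integer.Base using (+_; 1ℤ)
open import Data.List.Base using (List; []; _∷_; map; foldr; applyUpTo; upTo; filter; take; drop; cartesianProductWith)
open import Data.List.Membership.Propositional using (_∈_)
open import Data.List.Membership.Propositional.Properties using (∈-cartesianProductWith⁺; ∈-filter⁺; ∈-filter⁻; ∈-upTo⁺)
open import Data.List.Relation.Unary.Any using (here)
open import Data.List.Relation.Unary.All using ([])
import Data.List.Relation.Unary.AllPairs as AllPairs
open import Data.List.Relation.Unary.Unique.Propositional using (Unique)
import Data.List.Relation.Unary.Unique.Propositional.Properties as Unique
open import Data.Nat.Base as ℕ using (ℕ; zero; suc; _∸_; _≤_; _<_; _!; s≤s)
open import Data.Nat.ListAction using (sum)
import Data.Nat.Properties as ℕ
open import Data.Product.Base using (_×_; _,_; proj₂)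
open import Data.Rational as ℚ using (ℚ; 0ℚ; 1ℚ)
import Data.Rational.Properties as ℚ
import Data.Rational.Unnormalised.Base as ℚᵘ
import Data.Rational.Unnormalised.Properties as ℚᵘ
open import Algebra.Definitions.RawSemiring ℚ.+-*-rawSemiring using (_^_)
open import Data.Vec.Base using (Vec; []; _∷_; toList)
open import Data.Vec.Properties using (∷-injective)
open import Function.Base using (_∘_)
open import Function.Bundles using (_⇔_; mk⇔)
open import Relation.Binary.PropositionalEquality
open import Relation.Nullary.Decidable using (Dec; _×-dec_; _→-dec_)

-- ℚ[a] as lists of coefficients, constant term first.  Trailing zeros are allowed,
-- so polynomials are compared coefficientwise with _≈_.
Poly : Set
Poly = List ℚ

coeff : Poly → ℕ → ℚ
coeff []      _       = 0ℚ
coeff (c ∷ p) zero    = c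
coeff (c ∷ p) (suc n) = coeff p n

infix 4 _≈_
record _≈_ (p q : Poly) : Set where
  constructor mk≈
  field at : ∀ n → coeff p n ≡ coeff q n
open _≈_ public

const : ℚ → Poly
const c = c ∷ []

0ᴾ 1ᴾ : Poly
0ᴾ = []
1ᴾ = const 1ℚ

a : Poly
a = 0ℚ ∷ 1ℚ ∷ []

infixl 6 _+ᴾ_ _-ᴾ_
infixl 7 _*ᴾ_
infixr 7 _·_
infixr 8 _^ᴾ_

_+ᴾ_ : Poly → Poly → Poly
[]      +ᴾ q       = q
(c ∷ p) +ᴾ []      = c ∷ p
(c ∷ p) +ᴾ (d ∷ q) = (c ℚ.+ d) ∷ (p +ᴾ q)

_·_ : ℚ → Poly → Poly
c · p = map (c ℚ.*_) p

_-ᴾ_ : Poly → Poly → Poly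
p -ᴾ q = p +ᴾ (ℚ.- 1ℚ) · q

_*ᴾ_ : Poly → Poly → Poly
[]      *ᴾ q = []
(c ∷ p) *ᴾ q = c · q +ᴾ (0ℚ ∷ p *ᴾ q)

_^ᴾ_ : Poly → ℕ → Poly
p ^ᴾ zero  = 1ᴾ
p ^ᴾ suc n = p *ᴾ p ^ᴾ n

sumᴾ : List Poly → Poly
sumᴾ = foldr _+ᴾ_ 0ᴾ

prodᴾ : List Poly → Poly
prodᴾ = foldr _*ᴾ_ 1ᴾ

-- Both bounds are included; the sum is empty when m > n.
∑[_⋯_] : ℕ → ℕ → (ℕ → Poly) → Poly
∑[ m ⋯ n ] f = sumᴾ (applyUpTo (λ j → f (m ℕ.+ j)) (suc n ∸ m))

-- ℚ[a][[x]]: the value at n is the coefficient of xⁿ.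
Series : Set
Series = ℕ → Poly

infix 4 _≈ˢ_
_≈ˢ_ : Series → Series → Set
f ≈ˢ g = ∀ n → f n ≈ g n

infixl 7 _*ˢ_ _/ˢ_

_*ˢ_ : Series → Series → Series
(f *ˢ g) n = ∑[ 0 ⋯ n ] (λ k → f k *ᴾ g (n ∸ k))

1ˢ : Series
1ˢ zero    = 1ᴾ
1ˢ (suc n) = 0ᴾ

_-ˢ_ : Series → Series → Series
(f -ˢ g) n = f n -ᴾ g n

x*_ : Series → Series
(x* f) zero    = 0ᴾ
(x* f) (suc n) = f n

-- Long division; a quotient (see /ˢ-*ˢ) only when g has constant term 1.
_/ˢ_ : Series → Series → Series
(f /ˢ g) zero    = f 0
(f /ˢ g) (suc n) = ((λ m → f (suc m) -ᴾ f 0 *ᴾ g (suc m)) /ˢ g) n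

1/_! : ℕ → ℚ
1/ n ! = (1ℤ ℚ./ (n !)) {{n ℕ.!≢0}}

exp[x] : Series
exp[x] n = const (1/ n !)

exp[ax] : Series
exp[ax] n = 1/ n ! · a ^ᴾ n

-- The generating function x e^{ax} / (e^x - 1), with x cancelled so that
-- the denominator is invertible; bernoulli-gf is the uncancelled identity.
bernoulli : ℕ → Poly
bernoulli n = (+ (n !) ℚ./ 1) · (exp[ax] /ˢ ((exp[x] -ˢ 1ˢ) ∘ suc)) n

-- Membership in S_{i,r}; meant for 1 ≤ i ≤ r.  The entries n₁, …, n_r are
-- numbered from 1, so take j gives n₁, …, n_j and drop j gives n_{j+1}, …, n_r.
InS : (i r : ℕ) → Vec ℕ r → Set
InS i r n =
    sum (toList n) ≡ r
  × (∀ {j} → j < i → 1 ≤ j → sum (take j (toList n)) < j)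
  × (∀ {j} → j < r → i ≤ j → sum (drop j (toList n)) ≤ r ∸ j)

InS? : ∀ i r (n : Vec ℕ r) → Dec (InS i r n)
InS? i r n =
        (sum (toList n) ℕ.≟ r)
  ×-dec ℕ.allUpTo? (λ j → (1 ℕ.≤? j) →-dec (sum (take j (toList n)) ℕ.<? j)) i
  ×-dec ℕ.allUpTo? (λ j → (i ℕ.≤? j) →-dec (sum (drop j (toList n)) ℕ.≤? r ∸ j)) r

tuples≤ : ℕ → (r : ℕ) → List (Vec ℕ r)
tuples≤ b zero    = [] ∷ []
tuples≤ b (suc r) = cartesianProductWith _∷_ (upTo (suc b)) (tuples≤ b r)

-- Entries of a tuple with sum r are at most r, so the search space is
-- complete: see ∈S⇔InS and S-unique.
S : (i r : ℕ) → List (Vec ℕ r)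
S i r = filter (InS? i r) (tuples≤ r r)

C : (i r : ℕ) → Poly
C i r = ((ℚ.- 1ℚ) ^ r) ·
        sumᴾ (map (λ n → prodᴾ (map (λ nⱼ → 1/ nⱼ ! · bernoulli nⱼ) (toList n))) (S i r))

∈-tuples≤ : ∀ {b r} (n : Vec ℕ r) → sum (toList n) ≤ b → n ∈ tuples≤ b r
∈-tuples≤ []      _ = here refl
∈-tuples≤ (m ∷ n) h = ∈-cartesianProductWith⁺ _∷_
  (∈-upTo⁺ (s≤s (ℕ.≤-trans (ℕ.m≤m+n m _) h)))
  (∈-tuples≤ n (ℕ.≤-trans (ℕ.m≤n+m _ m) h))

∈S⇔InS : ∀ {i r} {n : Vec ℕ r} → n ∈ S i r ⇔ InS i r n
∈S⇔InS {i} {r} {n} = mk⇔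
  (λ n∈S → proj₂ (∈-filter⁻ (InS? i r) {xs = tuples≤ r r} n∈S))
  (λ p@(s≡r , _) → ∈-filter⁺ (InS? i r) (∈-tuples≤ n (ℕ.≤-reflexive s≡r)) p)

tuples≤-unique : ∀ b r → Unique (tuples≤ b r)
tuples≤-unique b zero    = [] AllPairs.∷ AllPairs.[]
tuples≤-unique b (suc r) =
  Unique.cartesianProductWith⁺ _∷_ ∷-injective (Unique.upTo⁺ (suc b)) (tuples≤-unique b r)

S-unique : ∀ i r → Unique (S i r)
S-unique i r = Unique.filter⁺ (InS? i r) (tuples≤-unique r r)

≈-refl : ∀ {p} → p ≈ p
≈-refl = mk≈ λ _ → refl

≈-sym : ∀ {p q} → p ≈ q → q ≈ p
≈-sym h = mk≈ λ n → sym (at h n)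

≈-trans : ∀ {p q s} → p ≈ q → q ≈ s → p ≈ s
≈-trans h k = mk≈ λ n → trans (at h n) (at k n)

coeff-+ : ∀ p q n → coeff (p +ᴾ q) n ≡ coeff p n ℚ.+ coeff q n
coeff-+ []      q       n       = sym (ℚ.+-identityˡ _)
coeff-+ (c ∷ p) []      n       = sym (ℚ.+-identityʳ _)
coeff-+ (c ∷ p) (d ∷ q) zero    = refl
coeff-+ (c ∷ p) (d ∷ q) (suc n) = coeff-+ p q n

coeff-· : ∀ c p n → coeff (c · p) n ≡ c ℚ.* coeff p n
coeff-· c []      n       = sym (ℚ.*-zeroʳ c)
coeff-· c (d ∷ p) zero    = refl
coeff-· c (d ∷ p) (suc n) = coeff-· c p n

+ᴾ-cong : ∀ {p p′ q q′} → p ≈ p′ → q ≈ q′ → p +ᴾ q ≈ p′ +ᴾ q′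
+ᴾ-cong {p} {p′} {q} {q′} h k = mk≈ λ n →
  trans (coeff-+ p q n) (trans (cong₂ ℚ._+_ (at h n) (at k n)) (sym (coeff-+ p′ q′ n)))

·-cong : ∀ c {p q} → p ≈ q → c · p ≈ c · q
·-cong c {p} {q} h = mk≈ λ n →
  trans (coeff-· c p n) (trans (cong (c ℚ.*_) (at h n)) (sym (coeff-· c q n)))

∷-cong : ∀ {c d p q} → c ≡ d → p ≈ q → c ∷ p ≈ d ∷ q
∷-cong e h = mk≈ λ { zero → e ; (suc n) → at h n }

+ᴾ-identityʳ : ∀ p → p +ᴾ 0ᴾ ≈ p
+ᴾ-identityʳ p = mk≈ λ n → trans (coeff-+ p [] n) (ℚ.+-identityʳ _)

*ᴾ-congˡ : ∀ p {q q′} → q ≈ q′ → p *ᴾ q ≈ p *ᴾ q′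
*ᴾ-congˡ []      h = ≈-refl
*ᴾ-congˡ (c ∷ p) h = +ᴾ-cong (·-cong c h) (∷-cong refl (*ᴾ-congˡ p h))

*ᴾ-zeroˡ : ∀ p q → p ≈ 0ᴾ → p *ᴾ q ≈ 0ᴾ
*ᴾ-zeroˡ []      q h = ≈-refl
*ᴾ-zeroˡ (c ∷ p) q h = +ᴾ-cong {p = c · q} {q = 0ℚ ∷ p *ᴾ q} {q′ = 0ᴾ}
  (mk≈ λ n → trans (coeff-· c q n) (trans (cong (ℚ._* coeff q n) (at h 0)) (ℚ.*-zeroˡ (coeff q n))))
  (mk≈ λ { zero → refl ; (suc n) → at (*ᴾ-zeroˡ p q (mk≈ λ m → at h (suc m))) n })

*ᴾ-congʳ : ∀ {p p′} q → p ≈ p′ → p *ᴾ q ≈ p′ *ᴾ q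
*ᴾ-congʳ {[]}    {p′}     q h = ≈-sym (*ᴾ-zeroˡ p′ q (≈-sym h))
*ᴾ-congʳ {c ∷ p} {[]}     q h = *ᴾ-zeroˡ (c ∷ p) q h
*ᴾ-congʳ {c ∷ p} {d ∷ p′} q h = +ᴾ-cong
  (mk≈ λ n → cong (λ e → coeff (e · q) n) (at h 0))
  (∷-cong refl (*ᴾ-congʳ {p} {p′} q (mk≈ λ n → at h (suc n))))

*ᴾ-zeroʳ : ∀ p → p *ᴾ 0ᴾ ≈ 0ᴾ
*ᴾ-zeroʳ []      = ≈-refl
*ᴾ-zeroʳ (c ∷ p) = mk≈ λ { zero → refl ; (suc n) → at (*ᴾ-zeroʳ p) n }

*ᴾ-identityʳ : ∀ p → p *ᴾ 1ᴾ ≈ p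
*ᴾ-identityʳ []      = ≈-refl
*ᴾ-identityʳ (c ∷ p) = ∷-cong
  (trans (ℚ.+-identityʳ _) (ℚ.*-identityʳ c)) (*ᴾ-identityʳ p)

+ᴾ-cancel-ᴾ : ∀ p q → p +ᴾ (q -ᴾ p) ≈ q
+ᴾ-cancel-ᴾ p q = mk≈ λ n → begin
  coeff (p +ᴾ (q -ᴾ p)) n                             ≡⟨ coeff-+ p _ n ⟩
  coeff p n ℚ.+ coeff (q -ᴾ p) n                       ≡⟨ cong (coeff p n ℚ.+_) (coeff-+ q _ n) ⟩
  coeff p n ℚ.+ (coeff q n ℚ.+ coeff ((ℚ.- 1ℚ) · p) n)
    ≡⟨ cong (λ e → coeff p n ℚ.+ (coeff q n ℚ.+ e)) (trans (coeff-· (ℚ.- 1ℚ) p n) (neg (coeff p n))) ⟩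
  coeff p n ℚ.+ (coeff q n ℚ.+ ℚ.- coeff p n)          ≡⟨ cong (coeff p n ℚ.+_) (ℚ.+-comm (coeff q n) _) ⟩
  coeff p n ℚ.+ (ℚ.- coeff p n ℚ.+ coeff q n)          ≡⟨ ℚ.+-assoc (coeff p n) _ _ ⟨
  (coeff p n ℚ.+ ℚ.- coeff p n) ℚ.+ coeff q n          ≡⟨ cong (ℚ._+ coeff q n) (ℚ.+-inverseʳ (coeff p n)) ⟩
  0ℚ ℚ.+ coeff q n                                     ≡⟨ ℚ.+-identityˡ _ ⟩
  coeff q n                                            ∎
  where
  open ≡-Reasoning
  neg : ∀ c → (ℚ.- 1ℚ) ℚ.* c ≡ ℚ.- c
  neg c = trans (sym (ℚ.neg-distribˡ-* 1ℚ c)) (cong ℚ.-_ (ℚ.*-identityˡ c))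

/ˢ-*ˢ : ∀ f g → g 0 ≈ 1ᴾ → (f /ˢ g) *ˢ g ≈ˢ f
/ˢ-*ˢ f g g₀ zero = ≈-trans (+ᴾ-identityʳ _) (≈-trans (*ᴾ-congˡ (f 0) g₀) (*ᴾ-identityʳ (f 0)))
/ˢ-*ˢ f g g₀ (suc n) = ≈-trans
  (+ᴾ-cong (≈-refl {f 0 *ᴾ g (suc n)}) (/ˢ-*ˢ (λ m → f (suc m) -ᴾ f 0 *ᴾ g (suc m)) g g₀ n))
  (+ᴾ-cancel-ᴾ (f 0 *ᴾ g (suc n)) (f (suc n)))

*ˢ-congʳ : ∀ {f f′} g → f ≈ˢ f′ → f *ˢ g ≈ˢ f′ *ˢ g
*ˢ-congʳ g h zero    = +ᴾ-cong (*ᴾ-congʳ (g 0) (h 0)) ≈-refl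
*ˢ-congʳ g h (suc n) = +ᴾ-cong (*ᴾ-congʳ (g (suc n)) (h 0)) (*ˢ-congʳ g (λ k → h (suc k)) n)

*ˢ-shift : ∀ f g → g 0 ≈ 0ᴾ → f *ˢ g ≈ˢ x* (f *ˢ (g ∘ suc))
*ˢ-shift f g g₀ zero = ≈-trans (+ᴾ-identityʳ _) (≈-trans (*ᴾ-congˡ (f 0) g₀) (*ᴾ-zeroʳ (f 0)))
*ˢ-shift f g g₀ (suc zero) = +ᴾ-cong (≈-refl {f 0 *ᴾ g 1}) (*ˢ-shift (f ∘ suc) g g₀ zero)
*ˢ-shift f g g₀ (suc (suc n)) = +ᴾ-cong (≈-refl {f 0 *ᴾ g (suc (suc n))}) (*ˢ-shift (f ∘ suc) g g₀ (suc n))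

1/n!*n!≡1 : ∀ n → 1/ n ! ℚ.* (+ (n !) ℚ./ 1) ≡ 1ℚ
1/n!*n!≡1 n = helper (n !) {{n ℕ.!≢0}}
  where
  helper : ∀ m .{{_ : ℕ.NonZero m}} → (1ℤ ℚ./ m) ℚ.* (+ m ℚ./ 1) ≡ 1ℚ
  helper m@(suc k) = ℚ.toℚᵘ-injective (ℚᵘ.≃-trans
    (ℚ.toℚᵘ-homo-* (1ℤ ℚ./ m) (+ m ℚ./ 1))
    (ℚᵘ.≃-trans
      (ℚᵘ.*-cong (ℚ.toℚᵘ-fromℚᵘ (1ℤ ℚᵘ./ m)) (ℚ.toℚᵘ-fromℚᵘ (+ m ℚᵘ./ 1)))
      (ℚᵘ.*≡* (cong +_ (ℕ.*-assoc 1 m 1)))))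

bernoulli-gf : (λ n → 1/ n ! · bernoulli n) *ˢ (exp[x] -ˢ 1ˢ) ≈ˢ x* exp[ax]
bernoulli-gf n = ≈-trans
  (*ˢ-congʳ {f′ = quot} (exp[x] -ˢ 1ˢ) unscale n)
  (≈-trans (*ˢ-shift quot (exp[x] -ˢ 1ˢ) (mk≈ λ { zero → refl ; (suc _) → refl }) n) (shifted n))
  where
  quot : Series
  quot = exp[ax] /ˢ ((exp[x] -ˢ 1ˢ) ∘ suc)

  unscale : (λ k → 1/ k ! · bernoulli k) ≈ˢ quot
  unscale k = mk≈ λ m → trans (coeff-· (1/ k !) (bernoulli k) m)
    (trans (cong (1/ k ! ℚ.*_) (coeff-· (+ (k !) ℚ./ 1) (quot k) m))
    (trans (sym (ℚ.*-assoc (1/ k !) _ _))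
    (trans (cong (ℚ._* coeff (quot k) m) (1/n!*n!≡1 k)) (ℚ.*-identityˡ _))))

  shifted : x* (quot *ˢ ((exp[x] -ˢ 1ˢ) ∘ suc)) ≈ˢ x* exp[ax]
  shifted zero    = ≈-refl
  shifted (suc m) = /ˢ-*ˢ exp[ax] _ (mk≈ λ _ → refl) m

-- Read (n₁, …, n_r) as the lattice path with steps n_j − 1 and weights w_n = −B_n(a)/n!; then C i r sums
-- the weights of the paths from 0 to 0 that are negative before step i and nonnegative from step i on.
-- Cutting such a path at its only up-crossing gives, for i = j + 2 and r = j + 2 + m,
--
--   C i r = w₀ Σ_{p ≤ j, q ≤ m} P j p · w_{p+q+2} · P m q,
--
-- with P m p the weight of the nonnegative paths of m steps from p to 0: the negative part, read
-- backwards, is again such a path, since no step goes down by more than 1.  Hence the symmetry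
-- C i r = C (r − i + 2) r.  Cutting a nonnegative path at its last zero before the end gives, for m ≥ 1,
--
--   C i r − Σ_k C i k · C (r−k) (r−k) = w₀² Σ_{p ≤ j, q < m} P j p · w_{p+q+3} · P (m−1) q.
--
-- The right-hand side is symmetric in j and m − 1, that is under i ↦ r − i + 1, and comparing the two
-- values of the left-hand side by means of the symmetry of C gives the theorem for i ≥ 2.  For i = 1
-- it is the cut at the last zero together with C 2 r = C r r.

module Submission where

open import Data.Nat.Base using (ℕ; _+_; _∸_; _≤_; _<_)
open import Defs using (_≈_; _+ᴾ_; _-ᴾ_; _*ᴾ_; ∑[_⋯_]; C)

open import Algebra.Bundles using (CommutativeMonoid; CommutativeSemiring)
import Algebra.Properties.CommutativeSemigroup as CommutativeSemigroupProperties
import Algebra.Properties.Semiring.Sum as SemiringSum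
open import Algebra.Structures using (IsCommutativeMonoid)
open import Algebra.Structures.Biased using (isCommutativeSemiringˡ)
open import Data.Bool.Base using (true; false)
open import Data.Fin.Base using (toℕ)
open import Data.Fin.Properties using (toℕ<n)
open import Data.List.Base using (List; []; _∷_; _++_; map; foldr; length; applyUpTo; filter; take; drop; cartesianProductWith)
open import Data.List.Properties using (filter-≐; filter-none; filter-accept)
open import Data.List.Relation.Unary.All using (universal)
open import Data.Nat.Base using (zero; suc; z≤n; s≤s)
open import Data.Nat.ListAction using (sum)
import Data.Nat.Properties as ℕ
open import Data.Product.Base using (_×_; _,_)
open import Data.Rational as ℚ using (ℚ; 0ℚ; 1ℚ)
import Data.Rational.Properties as ℚ
open import Algebra.Definitions.RawSemiring ℚ.+-*-rawSemiring using (_^_)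
open import Data.Sum.Base using (inj₁; inj₂)
open import Data.Vec.Base using (Vec; []; _∷_; toList)
open import Data.Vec.Properties using (length-toList)
open import Function.Base using (_∘_; id)
open import Function.Bundles using (_⇔_; mk⇔; Equivalence)
open import Level using (0ℓ)
open import Relation.Binary.Bundles using (Setoid)
open import Relation.Binary.PropositionalEquality as ≡ using (_≡_)
import Relation.Binary.Reasoning.Setoid as SetoidReasoning
open import Relation.Nullary.Decidable using (does; _×-dec_; _→-dec_)
open import Relation.Nullary.Negation using (¬_; contradiction)
open import Relation.Unary using (Decidable)
open import Defs hiding (_≈_; _+ᴾ_; _-ᴾ_; _*ᴾ_; ∑[_⋯_]; C)

-- Tuples as lattice paths, and removal of the first step.

sum-drop-length : ∀ {m} (v : Vec ℕ m) → sum (drop m (toList v)) ≡ 0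
sum-drop-length []      = ≡.refl
sum-drop-length (n ∷ v) = sum-drop-length v

-- The tuple n₁, …, n_m is the path with steps n₁ − 1, …, n_m − 1.  Since it ends at 0, its height
-- after t steps is m − t − (n_{t+1} + … + n_m).

Stay : ℕ → ∀ {m} → Vec ℕ m → Set
Stay p {m} v = p + sum (toList v) ≡ m × (∀ {t} → t < suc m → sum (drop t (toList v)) ≤ m ∸ t)

opaque
  Stay? : ∀ p {m} → Decidable (Stay p {m})
  Stay? p {m} v = (p + sum (toList v) ℕ.≟ m) ×-dec ℕ.allUpTo? (λ t → sum (drop t (toList v)) ℕ.≤? m ∸ t) (suc m)

-- Starts at height −h, is negative for the next j steps, then is nonnegative and ends at 0.
Bridge : ℕ → ℕ → ∀ {m} → Vec ℕ m → Set
Bridge j h {m} v =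
    sum (toList v) ≡ h + m
  × (∀ {t} → t < suc j → 1 ≤ t → sum (take t (toList v)) < h + t)
  × (∀ {t} → t < m → suc j ≤ t → sum (drop t (toList v)) ≤ m ∸ t)

opaque
  Bridge? : ∀ j h {m} → Decidable (Bridge j h {m})
  Bridge? j h {m} v =
          (sum (toList v) ℕ.≟ h + m)
    ×-dec ℕ.allUpTo? (λ t → (1 ℕ.≤? t) →-dec (sum (take t (toList v)) ℕ.<? h + t)) (suc j)
    ×-dec ℕ.allUpTo? (λ t → (suc j ℕ.≤? t) →-dec (sum (drop t (toList v)) ℕ.≤? m ∸ t)) m

-- The first step leads from p to p + n - 1. The equation p + n = q + 1 names this height without
-- subtraction and excludes p = n = 0. The bound at t = 0 only says that the start is nonnegative,
-- so it follows from the sum.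
Stay-∷ : ∀ {p n q m} {v : Vec ℕ m} → p + n ≡ suc q → Stay p (n ∷ v) ⇔ Stay q v
Stay-∷ {p} {n} {q} {m} {v} p+n≡1+q = mk⇔
  (λ (e , d) → ℕ.suc-injective (≡.trans (≡.sym regroup) e) , λ t<1+m → d (s≤s t<1+m))
  (λ (e , d) → ≡.trans regroup (≡.cong suc e) , λ
    { {zero}  _           → ℕ.m+n≤o⇒n≤o p (ℕ.≤-reflexive (≡.trans regroup (≡.cong suc e)))
    ; {suc t} (s≤s t<1+m) → d t<1+m
    })
  where
  regroup : p + (n + sum (toList v)) ≡ suc (q + sum (toList v))
  regroup = ≡.trans (≡.sym (ℕ.+-assoc p n _)) (≡.cong (_+ sum (toList v)) p+n≡1+q)

-- The entry 0 steps down from 0 to -1, against the bound at t = 1.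
Stay-∷-empty : ∀ {m} (v : Vec ℕ m) → ¬ Stay 0 (0 ∷ v)
Stay-∷-empty v (e , d) = ℕ.<-irrefl e (s≤s (d {1} (s≤s (s≤s z≤n))))

Bridge-∷-zero : ∀ {h p m} {v : Vec ℕ m} → Bridge 0 h (suc (h + p) ∷ v) ⇔ Stay p v
Bridge-∷-zero {h} {p} {m} {v} = mk⇔
  (λ (e , _ , d) → to-sum e , λ t<1+m → suffix (to-sum e) d (ℕ.≤-pred t<1+m))
  (λ (e , d) → ≡.trans regroup (≡.trans (≡.cong (λ k → suc (h + k)) e) (≡.sym (ℕ.+-suc h m)))
    , (λ t<1 1≤t → contradiction (ℕ.≤-trans t<1 1≤t) (ℕ.n≮n _))
    , λ { {suc t} t<1+m _ → d (ℕ.m<n⇒m<1+n (ℕ.≤-pred t<1+m)) })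
  where
  regroup : suc (h + p) + sum (toList v) ≡ suc (h + (p + sum (toList v)))
  regroup = ≡.cong suc (ℕ.+-assoc h p _)

  to-sum : suc (h + p) + sum (toList v) ≡ h + suc m → p + sum (toList v) ≡ m
  to-sum e = ℕ.+-cancelˡ-≡ h _ _ (ℕ.suc-injective (≡.trans (≡.sym regroup) (≡.trans e (ℕ.+-suc h m))))

  suffix : p + sum (toList v) ≡ m →
           (∀ {t} → t < suc m → 1 ≤ t → sum (drop t (suc (h + p) ∷ toList v)) ≤ suc m ∸ t) →
           ∀ {t} → t ≤ m → sum (drop t (toList v)) ≤ m ∸ t
  suffix e d {t} t≤m with ℕ.m≤n⇒m<n∨m≡n t≤m
  ... | inj₁ t<m    = d (s≤s t<m) (s≤s z≤n)
  -- `Bridge` states no bound at t = m, but there the suffix is empty.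
  ... | inj₂ ≡.refl = ℕ.≤-trans (ℕ.≤-reflexive (sum-drop-length v)) z≤n

Bridge-∷-zero-empty : ∀ {n h m} → n ≤ h → (v : Vec ℕ m) → ¬ Bridge 0 h (n ∷ v)
Bridge-∷-zero-empty {n} {h} {m} n≤h v (e , _ , d) = ℕ.<-irrefl ≡.refl (ℕ.≤-trans 1+m≤s (bound v d))
  where
  1+m≤s : suc m ≤ sum (toList v)
  1+m≤s = ℕ.+-cancelˡ-≤ h _ _ (ℕ.≤-trans (ℕ.≤-reflexive (≡.sym e)) (ℕ.+-monoˡ-≤ (sum (toList v)) n≤h))

  bound : ∀ {m} (v : Vec ℕ m) → (∀ {t} → t < suc m → 1 ≤ t → sum (drop t (n ∷ toList v)) ≤ suc m ∸ t) →
          sum (toList v) ≤ m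
  -- When the first step is also the last, no bound at t = 1 is available, but the remaining sum is
  -- 0.
  bound []      d = z≤n
  bound (k ∷ v) d = d {1} (s≤s (s≤s z≤n)) (s≤s z≤n)

-- The first step leads from -h to -(h + 1 - n). By n ≤ h this height is still negative and the
-- truncated subtraction is exact.
Bridge-∷-suc : ∀ {n j h m} {v : Vec ℕ m} → n ≤ h → Bridge (suc j) h (n ∷ v) ⇔ Bridge j (suc h ∸ n) v
Bridge-∷-suc {n} {j} {h} {m} {v} n≤h = mk⇔
  (λ (e , l , d) →
      ℕ.+-cancelˡ-≡ n _ _ (≡.trans e (shift m))
    , (λ t<1+j 1≤t → ℕ.+-cancelˡ-< n _ _ (ℕ.<-≤-trans (l (s≤s t<1+j) (s≤s z≤n)) (ℕ.≤-reflexive (shift _))))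
    , λ t<m 1+j≤t → d (s≤s t<m) (s≤s 1+j≤t))
  (λ (e , l , d) →
      ≡.trans (≡.cong (n +_) e) (≡.sym (shift m))
    , (λ { {suc zero}    _       _ → ℕ.≤-<-trans (ℕ.≤-reflexive (ℕ.+-identityʳ n))
                                      (ℕ.≤-<-trans n≤h (ℕ.≤-reflexive (ℕ.+-comm 1 h)))
         ; {suc (suc t)} t<2+j _ → ℕ.<-≤-trans (ℕ.+-monoʳ-< n (l (ℕ.≤-pred t<2+j) (s≤s z≤n)))
                                      (ℕ.≤-reflexive (≡.sym (shift _))) })
    , λ { {suc t} t<1+m 2+j≤t → d (ℕ.≤-pred t<1+m) (ℕ.≤-pred 2+j≤t) })
  where
  shift : ∀ k → h + suc k ≡ n + ((suc h ∸ n) + k)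
  shift k = ≡.trans (ℕ.+-suc h k) (≡.trans (≡.cong (_+ k) (≡.sym (ℕ.m+[n∸m]≡n (ℕ.m≤n⇒m≤1+n n≤h)))) (ℕ.+-assoc n _ k))

Bridge-∷-suc-empty : ∀ {n j h m} → h < n → (v : Vec ℕ m) → ¬ Bridge (suc j) h (n ∷ v)
Bridge-∷-suc-empty {n} {j} {h} h<n v (_ , l , _) = ℕ.<-irrefl ≡.refl (ℕ.≤-trans
  (ℕ.≤-trans (l {1} (s≤s (s≤s z≤n)) (s≤s z≤n)) (ℕ.≤-reflexive (ℕ.+-comm h 1)))
  (ℕ.≤-trans h<n (ℕ.m≤m+n n 0)))

module PathSums (R : CommutativeSemiring 0ℓ 0ℓ) (w : ℕ → CommutativeSemiring.Carrier R) where

  open CommutativeSemiring R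
    using (Carrier; 0#; 1#; setoid; refl; sym; trans; reflexive;
           +-cong; +-congˡ; +-congʳ; +-assoc; +-comm; +-identityˡ; +-identityʳ;
           *-cong; *-congˡ; *-congʳ; *-assoc; *-comm; *-identityˡ;
           zeroˡ; zeroʳ; distribˡ; distribʳ; +-commutativeSemigroup; *-commutativeSemigroup; semiring)
    renaming (_≈_ to _≃_; _+_ to infixl 6 _⊕_; _*_ to infixl 7 _⊛_)
  open SemiringSum semiring using (sum-cong-≋; sum-replicate-zero; ∑-comm; ∑-distrib-+; *-distribˡ-sum; *-distribʳ-sum)
    renaming (sum to sumᶠ)
  open SetoidReasoning setoid
  open CommutativeSemigroupProperties +-commutativeSemigroup using () renaming (x∙yz≈y∙xz to x+yz≈y+xz)
  open CommutativeSemigroupProperties *-commutativeSemigroup using (x∙yz≈y∙xz)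

  -- Finite sums in a commutative semiring.

  opaque
    ∑ : ℕ → (ℕ → Carrier) → Carrier
    ∑ n f = sumᶠ {n} (f ∘ toℕ)

    ∑-empty : ∀ f → ∑ 0 f ≃ 0#
    ∑-empty f = refl

    ∑-suc : ∀ n f → ∑ (suc n) f ≃ f 0 ⊕ ∑ n (f ∘ suc)
    ∑-suc n f = refl

    ∑-cong : ∀ n {f g} → (∀ k → k < n → f k ≃ g k) → ∑ n f ≃ ∑ n g
    ∑-cong n h = sum-cong-≋ (λ i → h (toℕ i) (toℕ<n i))

    ∑-zero : ∀ n {f} → (∀ k → k < n → f k ≃ 0#) → ∑ n f ≃ 0#
    ∑-zero n h = trans (∑-cong n h) (sum-replicate-zero n)

    ∑-*ˡ : ∀ n x f → x ⊛ ∑ n f ≃ ∑ n (λ k → x ⊛ f k)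
    ∑-*ˡ n x f = *-distribˡ-sum {n} x (f ∘ toℕ)

    ∑-*ʳ : ∀ n x f → ∑ n f ⊛ x ≃ ∑ n (λ k → f k ⊛ x)
    ∑-*ʳ n x f = *-distribʳ-sum {n} x (f ∘ toℕ)

    ∑-+ : ∀ n f g → ∑ n (λ k → f k ⊕ g k) ≃ ∑ n f ⊕ ∑ n g
    ∑-+ n f g = ∑-distrib-+ {n} (f ∘ toℕ) (g ∘ toℕ)

    ∑-swap : ∀ m n (f : ℕ → ℕ → Carrier) → ∑ m (λ i → ∑ n (f i)) ≃ ∑ n (λ j → ∑ m (λ i → f i j))
    ∑-swap m n f = ∑-comm {m} {n} (λ i j → f (toℕ i) (toℕ j))

  ∑-cong′ : ∀ n {f g} → (∀ k → f k ≃ g k) → ∑ n f ≃ ∑ n g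
  ∑-cong′ n h = ∑-cong n (λ k _ → h k)

  ∑-one : ∀ f → ∑ 1 f ≃ f 0
  ∑-one f = trans (∑-suc 0 f) (trans (+-congˡ (∑-empty _)) (+-identityʳ _))

  ∑-split : ∀ m n f → ∑ (m + n) f ≃ ∑ m f ⊕ ∑ n (λ k → f (m + k))
  ∑-split zero    n f = sym (trans (+-congʳ (∑-empty f)) (+-identityˡ _))
  ∑-split (suc m) n f = begin
    ∑ (suc m + n) f                                        ≈⟨ ∑-suc (m + n) f ⟩
    f 0 ⊕ ∑ (m + n) (f ∘ suc)                              ≈⟨ +-congˡ (∑-split m n (f ∘ suc)) ⟩
    f 0 ⊕ (∑ m (f ∘ suc) ⊕ ∑ n (λ k → f (suc m + k)))      ≈⟨ +-assoc _ _ _ ⟨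
    f 0 ⊕ ∑ m (f ∘ suc) ⊕ ∑ n (λ k → f (suc m + k))        ≈⟨ +-congʳ (∑-suc m f) ⟨
    ∑ (suc m) f ⊕ ∑ n (λ k → f (suc m + k))                ∎

  ∑-last : ∀ n f → ∑ (suc n) f ≃ ∑ n f ⊕ f n
  ∑-last n f = begin
    ∑ (suc n) f                          ≡⟨ ≡.cong (λ m → ∑ m f) (ℕ.+-comm 1 n) ⟩
    ∑ (n + 1) f                          ≈⟨ ∑-split n 1 f ⟩
    ∑ n f ⊕ ∑ 1 (λ k → f (n + k))        ≈⟨ +-congˡ (∑-one _) ⟩
    ∑ n f ⊕ f (n + 0)                    ≡⟨ ≡.cong (λ m → ∑ n f ⊕ f m) (ℕ.+-identityʳ n) ⟩
    ∑ n f ⊕ f n                          ∎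

  ∑-truncate : ∀ {m n} f → m ≤ n → (∀ k → m ≤ k → f k ≃ 0#) → ∑ n f ≃ ∑ m f
  ∑-truncate {m} {n} f m≤n h = begin
    ∑ n f                                  ≡⟨ ≡.cong (λ n → ∑ n f) (ℕ.m+[n∸m]≡n m≤n) ⟨
    ∑ (m + (n ∸ m)) f                      ≈⟨ ∑-split m (n ∸ m) f ⟩
    ∑ m f ⊕ ∑ (n ∸ m) (λ k → f (m + k))    ≈⟨ +-congˡ (∑-zero (n ∸ m) (λ k _ → h (m + k) (ℕ.m≤m+n m k))) ⟩
    ∑ m f ⊕ 0#                             ≈⟨ +-identityʳ _ ⟩
    ∑ m f                                  ∎

  ∑-reverse : ∀ n f → ∑ (suc n) f ≃ ∑ (suc n) (λ k → f (n ∸ k))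
  ∑-reverse zero    f = trans (∑-one f) (sym (∑-one _))
  ∑-reverse (suc n) f = begin
    ∑ (suc (suc n)) f                            ≈⟨ ∑-last (suc n) f ⟩
    ∑ (suc n) f ⊕ f (suc n)                      ≈⟨ +-comm _ _ ⟩
    f (suc n) ⊕ ∑ (suc n) f                      ≈⟨ +-congˡ (∑-reverse n f) ⟩
    f (suc n) ⊕ ∑ (suc n) (λ k → f (n ∸ k))      ≈⟨ ∑-suc (suc n) _ ⟨
    ∑ (suc (suc n)) (λ k → f (suc n ∸ k))        ∎

  -- Associativity of row vector times matrix times column vector.
  ∑-bilinear : ∀ m n (x y : ℕ → Carrier) (f : ℕ → ℕ → Carrier) →
               ∑ m (λ i → x i ⊛ ∑ n (λ j → f i j ⊛ y j)) ≃ ∑ n (λ j → ∑ m (λ i → x i ⊛ f i j) ⊛ y j)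
  ∑-bilinear m n x y f = begin
    ∑ m (λ i → x i ⊛ ∑ n (λ j → f i j ⊛ y j))      ≈⟨ ∑-cong′ m (λ i → ∑-*ˡ n (x i) _) ⟩
    ∑ m (λ i → ∑ n (λ j → x i ⊛ (f i j ⊛ y j)))    ≈⟨ ∑-swap m n _ ⟩
    ∑ n (λ j → ∑ m (λ i → x i ⊛ (f i j ⊛ y j)))    ≈⟨ ∑-cong′ n (λ j → ∑-cong′ m (λ i → sym (*-assoc _ _ _))) ⟩
    ∑ n (λ j → ∑ m (λ i → (x i ⊛ f i j) ⊛ y j))    ≈⟨ ∑-cong′ n (λ j → sym (∑-*ʳ m (y j) _)) ⟩
    ∑ n (λ j → ∑ m (λ i → x i ⊛ f i j) ⊛ y j)      ∎

  -- Nonnegative paths and their cut at the last zero.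

  -- The weight of a step from height p to height n − 1; it is 0 when n < p.
  step : ℕ → ℕ → Carrier
  step zero    n       = w n
  step (suc p) zero    = 0#
  step (suc p) (suc n) = step p n

  step-≤ : ∀ {p n} → p ≤ n → step p n ≡ w (n ∸ p)
  step-≤ z≤n       = ≡.refl
  step-≤ (s≤s p≤n) = step-≤ p≤n

  step-> : ∀ {p n} → n < p → step p n ≡ 0#
  step-> {suc p} {zero}  _         = ≡.refl
  step-> {suc p} {suc n} (s≤s n<p) = step-> n<p

  -- Paths of m steps from height p to height 0 that stay at heights ≥ 0.
  stay : ℕ → ℕ → Carrier
  stay zero    zero    = 1#
  stay zero    (suc p) = 0#
  stay (suc m) p       = ∑ (suc m) (λ q → step p (suc q) ⊛ stay m q)

  -- A step lowers the height by at most 1.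
  stay-> : ∀ {m p} → m < p → stay m p ≃ 0#
  stay-> {zero}  {suc p} _         = refl
  stay-> {suc m} {suc p} (s≤s m<p) = ∑-zero (suc m) λ q q<1+m →
    trans (*-congʳ (reflexive (step-> (ℕ.≤-<-trans (ℕ.≤-pred q<1+m) m<p)))) (zeroˡ _)

  ∑-stay : ∀ {m n} (x : ℕ → Carrier) → m < n → ∑ n (λ q → x q ⊛ stay m q) ≃ ∑ (suc m) (λ q → x q ⊛ stay m q)
  ∑-stay x m<n = ∑-truncate _ m<n (λ k m<k → trans (*-congˡ (stay-> m<k)) (zeroʳ _))

  -- For s = 2, a jump from -(p + 1) to q, whose entry is p + q + 2, followed by a nonnegative path.
  -- For s = 3 the jump goes to q + 1 instead.
  tail-weight : ℕ → ℕ → ℕ → Carrier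
  tail-weight s m p = ∑ (suc m) (λ q → w (s + (p + q)) ⊛ stay m q)

  -- Paths of n + 1 steps from 0 to 0 that are positive in between, or, reversed, negative in between.
  prime : ℕ → Carrier
  prime zero    = w 1
  prime (suc m) = w 0 ⊛ tail-weight 2 m 0

  -- Paths of n steps from height q that reach height 0 only at the end.
  fall : ℕ → ℕ → Carrier
  fall zero    q       = stay zero q
  fall (suc n) zero    = 0#
  fall (suc n) (suc q) = w 0 ⊛ stay n q

  -- `stay zero q` is the indicator of q = 0. A step followed by a fall is a prime path if it starts
  -- at 0, and a longer fall otherwise.
  fall-step : ∀ n q → ∑ (suc n) (λ r → step q (suc r) ⊛ fall n r) ≃ stay zero q ⊛ prime n ⊕ fall (suc n) q
  fall-step zero q = trans (∑-one _) (first q)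
    where
    first : ∀ q → step q 1 ⊛ stay zero 0 ≃ stay zero q ⊛ prime 0 ⊕ fall 1 q
    first zero          = sym (trans (+-identityʳ _) (*-comm _ _))
    first (suc zero)    = sym (trans (+-congʳ (zeroˡ _)) (+-identityˡ _))
    first (suc (suc q)) = trans (zeroˡ _) (sym (trans (+-cong (zeroˡ _) (zeroʳ _)) (+-identityˡ _)))
  fall-step (suc n) q = trans (trans (∑-suc (suc n) _) (trans (+-cong (zeroʳ _) shift) (+-identityˡ _))) (rest q)
    where
    shift : ∑ (suc n) (λ r → step q (suc (suc r)) ⊛ (w 0 ⊛ stay n r)) ≃
            w 0 ⊛ ∑ (suc n) (λ r → step q (suc (suc r)) ⊛ stay n r)
    shift = trans (∑-cong′ (suc n) (λ r → x∙yz≈y∙xz _ _ _)) (sym (∑-*ˡ (suc n) (w 0) _))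

    rest : ∀ q → w 0 ⊛ ∑ (suc n) (λ r → step q (suc (suc r)) ⊛ stay n r) ≃
                 stay zero q ⊛ prime (suc n) ⊕ fall (suc (suc n)) q
    rest zero    = sym (trans (+-identityʳ _) (*-identityˡ _))
    rest (suc q) = sym (trans (+-congʳ (zeroˡ _)) (+-identityˡ _))

  -- Cut at the last visit to 0 before the end.
  stay-decomposition : ∀ n q → stay n q ≃ ∑ n (λ t → stay t q ⊛ prime (n ∸ suc t)) ⊕ fall n q
  stay-decomposition zero    q = sym (trans (+-congʳ (∑-empty _)) (+-identityˡ _))
  stay-decomposition (suc n) q = begin
    ∑ (suc n) (λ r → step q (suc r) ⊛ stay n r)
      ≈⟨ ∑-cong′ (suc n) (λ r → trans (*-congˡ (stay-decomposition n r)) (distribˡ _ _ _)) ⟩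
    ∑ (suc n) (λ r → step q (suc r) ⊛ ∑ n (λ t → stay t r ⊛ prime (n ∸ suc t)) ⊕ step q (suc r) ⊛ fall n r)
      ≈⟨ ∑-+ (suc n) _ _ ⟩
    ∑ (suc n) (λ r → step q (suc r) ⊛ ∑ n (λ t → stay t r ⊛ prime (n ∸ suc t))) ⊕
    ∑ (suc n) (λ r → step q (suc r) ⊛ fall n r)
      ≈⟨ +-cong (∑-bilinear (suc n) n _ _ _) (fall-step n q) ⟩
    ∑ n (λ t → ∑ (suc n) (λ r → step q (suc r) ⊛ stay t r) ⊛ prime (n ∸ suc t)) ⊕
    (stay zero q ⊛ prime n ⊕ fall (suc n) q)
      ≈⟨ +-congʳ (∑-cong n (λ t t<n → *-congʳ (∑-stay _ (ℕ.m<n⇒m<1+n t<n)))) ⟩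
    ∑ n (λ t → stay (suc t) q ⊛ prime (n ∸ suc t)) ⊕ (stay zero q ⊛ prime n ⊕ fall (suc n) q)
      -- `fall-step` has supplied the missing summand t = 0: a path that starts at 0 and returns
      -- there only at the end.
      ≈⟨ trans (x+yz≈y+xz _ _ _) (sym (+-assoc _ _ _)) ⟩
    (stay zero q ⊛ prime n ⊕ ∑ n (λ t → stay (suc t) q ⊛ prime (n ∸ suc t))) ⊕ fall (suc n) q
      ≈⟨ +-congʳ (∑-suc n _) ⟨
    ∑ (suc n) (λ t → stay t q ⊛ prime (n ∸ t)) ⊕ fall (suc n) q
      ∎

  -- The part after the jump is cut at its last zero before the end. If there is none, it stays at
  -- heights ≥ 1 until a final step of weight `w 0`; lowering it by 1 changes s from 2 to 3.
  tail-weight-decomposition : ∀ m p → tail-weight 2 (suc m) p ≃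
    ∑ (suc m) (λ t → tail-weight 2 t p ⊛ prime (m ∸ t)) ⊕ w 0 ⊛ tail-weight 3 m p
  tail-weight-decomposition m p = begin
    ∑ (2 + m) (λ q → x q ⊛ stay (suc m) q)
      ≈⟨ ∑-cong′ (2 + m) (λ q → trans (*-congˡ (stay-decomposition (suc m) q)) (distribˡ _ _ _)) ⟩
    ∑ (2 + m) (λ q → x q ⊛ ∑ (suc m) (λ t → stay t q ⊛ prime (m ∸ t)) ⊕ x q ⊛ fall (suc m) q)
      ≈⟨ ∑-+ (2 + m) _ _ ⟩
    ∑ (2 + m) (λ q → x q ⊛ ∑ (suc m) (λ t → stay t q ⊛ prime (m ∸ t))) ⊕ ∑ (2 + m) (λ q → x q ⊛ fall (suc m) q)
      ≈⟨ +-cong (∑-bilinear (2 + m) (suc m) _ _ _) (trans (∑-suc (suc m) _) (trans (+-congʳ (zeroʳ _)) (+-identityˡ _))) ⟩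
    ∑ (suc m) (λ t → ∑ (2 + m) (λ q → x q ⊛ stay t q) ⊛ prime (m ∸ t)) ⊕
    ∑ (suc m) (λ q → x (suc q) ⊛ (w 0 ⊛ stay m q))
      ≈⟨ +-cong (∑-cong (suc m) (λ t t<1+m → *-congʳ (∑-stay x (ℕ.m<n⇒m<1+n t<1+m))))
                (trans (∑-cong′ (suc m) (λ q → trans (x∙yz≈y∙xz _ _ _)
                          (*-congˡ (*-congʳ (reflexive (≡.cong (w ∘ (2 +_)) (ℕ.+-suc p q)))))))
                       (sym (∑-*ˡ (suc m) (w 0) _))) ⟩
    ∑ (suc m) (λ t → tail-weight 2 t p ⊛ prime (m ∸ t)) ⊕ w 0 ⊛ tail-weight 3 m p
      ∎
    where
    x : ℕ → Carrier
    x q = w (2 + (p + q))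

  -- Bridges: symmetry, decomposition and exchange.

  -- The bilinear form of the Hankel matrix with entries w (s + p + q), taken on the vectors
  -- `stay j` and `stay m`. It is symmetric because the entries depend only on p + q.
  hankel : ℕ → ℕ → ℕ → Carrier
  hankel s j m = ∑ (suc j) (λ p → stay j p ⊛ tail-weight s m p)

  hankel-sym : ∀ s j m → hankel s j m ≃ hankel s m j
  hankel-sym s j m = begin
    ∑ (suc j) (λ p → stay j p ⊛ ∑ (suc m) (λ q → w (s + (p + q)) ⊛ stay m q))
      ≈⟨ ∑-bilinear (suc j) (suc m) _ _ _ ⟩
    ∑ (suc m) (λ q → ∑ (suc j) (λ p → stay j p ⊛ w (s + (p + q))) ⊛ stay m q)
      ≈⟨ ∑-cong′ (suc m) (λ q → trans (*-comm _ _) (*-congˡ (∑-cong′ (suc j) (λ p →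
           trans (*-comm _ _) (*-congʳ (reflexive (≡.cong (w ∘ (s +_)) (ℕ.+-comm p q)))))))) ⟩
    ∑ (suc m) (λ q → stay m q ⊛ ∑ (suc j) (λ p → w (s + (q + p)) ⊛ stay j p))
      ∎

  -- The factor `w 0` is the forced first step from 0 to -1. The j further negative steps appear in
  -- `hankel` read backwards.
  bridge : ℕ → ℕ → Carrier
  bridge j m = w 0 ⊛ hankel 2 j m

  bridge-sym : ∀ j m → bridge j m ≃ bridge m j
  bridge-sym j m = *-congˡ (hankel-sym 2 j m)

  bridge-zero : ∀ m → bridge 0 m ≃ prime (suc m)
  bridge-zero m = *-congˡ (trans (∑-one _) (*-identityˡ _))

  -- Only the nonnegative part is cut. The last term collects the bridges whose nonnegative part
  -- reaches 0 only at the end, and it is symmetric in j and m.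
  bridge-decomposition : ∀ j m → bridge j (suc m) ≃
    ∑ (suc m) (λ t → bridge j t ⊛ prime (m ∸ t)) ⊕ w 0 ⊛ (w 0 ⊛ hankel 3 j m)
  bridge-decomposition j m = begin
    w 0 ⊛ ∑ (suc j) (λ p → stay j p ⊛ tail-weight 2 (suc m) p)
      ≈⟨ *-congˡ (∑-cong′ (suc j) (λ p → trans (*-congˡ (tail-weight-decomposition m p)) (distribˡ _ _ _))) ⟩
    w 0 ⊛ ∑ (suc j) (λ p → stay j p ⊛ ∑ (suc m) (λ t → tail-weight 2 t p ⊛ prime (m ∸ t))
                           ⊕ stay j p ⊛ (w 0 ⊛ tail-weight 3 m p))
      ≈⟨ *-congˡ (∑-+ (suc j) _ _) ⟩
    w 0 ⊛ (∑ (suc j) (λ p → stay j p ⊛ ∑ (suc m) (λ t → tail-weight 2 t p ⊛ prime (m ∸ t)))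
           ⊕ ∑ (suc j) (λ p → stay j p ⊛ (w 0 ⊛ tail-weight 3 m p)))
      ≈⟨ *-congˡ (+-cong (∑-bilinear (suc j) (suc m) _ _ _)
                         (trans (∑-cong′ (suc j) (λ p → x∙yz≈y∙xz _ _ _)) (sym (∑-*ˡ (suc j) (w 0) _)))) ⟩
    w 0 ⊛ (∑ (suc m) (λ t → hankel 2 j t ⊛ prime (m ∸ t)) ⊕ w 0 ⊛ hankel 3 j m)
      ≈⟨ trans (distribˡ _ _ _) (+-congʳ (trans (∑-*ˡ (suc m) (w 0) _) (∑-cong′ (suc m) (λ t → sym (*-assoc _ _ _))))) ⟩
    ∑ (suc m) (λ t → bridge j t ⊛ prime (m ∸ t)) ⊕ w 0 ⊛ (w 0 ⊛ hankel 3 j m)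
      ∎

  -- Both sides equal `T₁` plus `T₂` plus the symmetric remainder. Sums are placed on both sides
  -- since a semiring has no subtraction.
  bridge-exchange : ∀ j m →
    bridge (suc j) m ⊕ ∑ (suc m) (λ t → bridge j t ⊛ prime (m ∸ t)) ≃
    bridge j (suc m) ⊕ ∑ (suc j) (λ t → bridge m t ⊛ prime (j ∸ t))
  bridge-exchange j m = begin
    bridge (suc j) m ⊕ T₂      ≈⟨ +-congʳ (trans (bridge-sym (suc j) m) (bridge-decomposition m j)) ⟩
    (T₁ ⊕ h m j) ⊕ T₂          ≈⟨ +-congʳ (+-congˡ (*-congˡ (*-congˡ (hankel-sym 3 m j)))) ⟩
    (T₁ ⊕ h j m) ⊕ T₂          ≈⟨ trans (+-assoc _ _ _) (trans (+-congˡ (+-comm _ _)) (+-comm _ _)) ⟩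
    (T₂ ⊕ h j m) ⊕ T₁          ≈⟨ +-congʳ (sym (bridge-decomposition j m)) ⟩
    bridge j (suc m) ⊕ T₁      ∎
    where
    T₁ T₂ : Carrier
    T₁ = ∑ (suc j) (λ t → bridge m t ⊛ prime (j ∸ t))
    T₂ = ∑ (suc m) (λ t → bridge j t ⊛ prime (m ∸ t))
    h : ℕ → ℕ → Carrier
    h j m = w 0 ⊛ (w 0 ⊛ hankel 3 j m)

  -- The term `fall` vanishes because the start is itself a zero; the summand t = 0 is the prime
  -- path.
  stay-zero-decomposition : ∀ n →
    stay (suc n) 0 ≃ prime n ⊕ ∑ n (λ t → stay (suc t) 0 ⊛ prime (n ∸ suc t))
  stay-zero-decomposition n =
    trans (stay-decomposition (suc n) 0) (trans (+-identityʳ _) (trans (∑-suc n _) (+-congʳ (*-identityˡ _))))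

  -- Reading the negative part backwards.

  -- Paths of j + 1 + m steps from height −(p + 1) to 0 that are negative for j steps after the start and
  -- nonnegative afterwards.
  rise : ℕ → ℕ → ℕ → Carrier
  rise zero    m p = tail-weight 2 m p
  rise (suc j) m p = ∑ (2 + p) (λ n → w n ⊛ rise j m (suc p ∸ n))

  -- The steps between negative heights have the transposed matrix of the steps between heights ≥ 0.
  stay-transpose : ∀ a (x : ℕ → Carrier) →
    ∑ (suc a) (λ p → stay a p ⊛ ∑ (2 + p) (λ n → w n ⊛ x (suc p ∸ n))) ≃ ∑ (2 + a) (λ p → stay (suc a) p ⊛ x p)
  stay-transpose a x = begin
    ∑ (suc a) (λ p → stay a p ⊛ ∑ (2 + p) (λ n → w n ⊛ x (suc p ∸ n)))
      ≈⟨ ∑-cong (suc a) (λ p p<1+a → *-congˡ (inner p p<1+a)) ⟩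
    ∑ (suc a) (λ p → stay a p ⊛ ∑ (2 + a) (λ q → step q (suc p) ⊛ x q))
      ≈⟨ ∑-bilinear (suc a) (2 + a) _ _ _ ⟩
    ∑ (2 + a) (λ q → ∑ (suc a) (λ p → stay a p ⊛ step q (suc p)) ⊛ x q)
      ≈⟨ ∑-cong′ (2 + a) (λ q → *-congʳ (∑-cong′ (suc a) (λ p → *-comm _ _))) ⟩
    ∑ (2 + a) (λ q → stay (suc a) q ⊛ x q)
      ∎
    where
    inner : ∀ p → p < suc a → ∑ (2 + p) (λ n → w n ⊛ x (suc p ∸ n)) ≃ ∑ (2 + a) (λ q → step q (suc p) ⊛ x q)
    inner p p<1+a = begin
      ∑ (2 + p) (λ n → w n ⊛ x (suc p ∸ n))
        -- The new index is q = p + 1 - n: the step leads from -(p + 1) to -(q + 1).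
        ≈⟨ ∑-reverse (suc p) _ ⟩
      ∑ (2 + p) (λ q → w (suc p ∸ q) ⊛ x (suc p ∸ (suc p ∸ q)))
        ≈⟨ ∑-cong (2 + p) (λ q q<2+p → *-cong (reflexive (≡.sym (step-≤ (ℕ.≤-pred q<2+p))))
                                              (reflexive (≡.cong x (ℕ.m∸[m∸n]≡n (ℕ.≤-pred q<2+p))))) ⟩
      ∑ (2 + p) (λ q → step q (suc p) ⊛ x q)
        ≈⟨ ∑-truncate _ (s≤s p<1+a) (λ q 2+p≤q → trans (*-congʳ (reflexive (step-> 2+p≤q))) (zeroˡ _)) ⟨
      ∑ (2 + a) (λ q → step q (suc p) ⊛ x q)
        ∎

  -- The parameter a counts the negative steps already read backwards. Each induction step moves one
  -- more from `rise` into `stay`; a = 0 is the case of interest.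
  stay-rise : ∀ a j m → ∑ (suc a) (λ p → stay a p ⊛ rise j m p) ≃ hankel 2 (a + j) m
  stay-rise a zero    m = reflexive (≡.cong (λ a → hankel 2 a m) (≡.sym (ℕ.+-identityʳ a)))
  stay-rise a (suc j) m = begin
    ∑ (suc a) (λ p → stay a p ⊛ rise (suc j) m p)    ≈⟨ stay-transpose a (rise j m) ⟩
    ∑ (2 + a) (λ p → stay (suc a) p ⊛ rise j m p)    ≈⟨ stay-rise (suc a) j m ⟩
    hankel 2 (suc a + j) m                           ≡⟨ ≡.cong (λ a → hankel 2 a m) (ℕ.+-suc a j) ⟨
    hankel 2 (a + suc j) m                           ∎

  rise-hankel : ∀ j m → rise j m 0 ≃ hankel 2 j m
  rise-hankel j m = trans (sym (trans (∑-one _) (*-identityˡ _))) (stay-rise 0 j m)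

  -- Sums over filtered lists of tuples as path sums.

  weight : ∀ {m} → Vec ℕ m → Carrier
  weight v = foldr _⊛_ 1# (map w (toList v))

  listTotal : ∀ {m} {Q : Vec ℕ m → Set} → Decidable Q → List (Vec ℕ m) → Carrier
  listTotal Q? vs = foldr _⊕_ 0# (map weight (filter Q? vs))

  listTotal-++ : ∀ {m} {Q : Vec ℕ m → Set} (Q? : Decidable Q) us vs →
                 listTotal Q? (us ++ vs) ≃ listTotal Q? us ⊕ listTotal Q? vs
  listTotal-++ Q? []       vs = sym (+-identityˡ _)
  listTotal-++ Q? (u ∷ us) vs with does (Q? u)
  ... | false = listTotal-++ Q? us vs
  ... | true  = trans (+-congˡ (listTotal-++ Q? us vs)) (sym (+-assoc _ _ _))

  listTotal-map-∷ : ∀ {m} {Q : Vec ℕ (suc m) → Set} (Q? : Decidable Q) n vs →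
                    listTotal Q? (map (n ∷_) vs) ≃ w n ⊛ listTotal (Q? ∘ (n ∷_)) vs
  listTotal-map-∷ Q? n []       = sym (zeroʳ _)
  listTotal-map-∷ Q? n (v ∷ vs) with does (Q? (n ∷ v))
  ... | false = listTotal-map-∷ Q? n vs
  ... | true  = trans (+-congˡ (listTotal-map-∷ Q? n vs)) (sym (distribˡ _ _ _))

  listTotal-product : ∀ {m} {Q : Vec ℕ (suc m) → Set} (Q? : Decidable Q) N g vs →
    listTotal Q? (cartesianProductWith _∷_ (applyUpTo g N) vs) ≃ ∑ N (λ n → w (g n) ⊛ listTotal (Q? ∘ (g n ∷_)) vs)
  listTotal-product Q? zero    g vs = sym (∑-empty _)
  listTotal-product Q? (suc N) g vs = trans (listTotal-++ Q? (map (g 0 ∷_) vs) _)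
    (trans (+-cong (listTotal-map-∷ Q? (g 0) vs) (listTotal-product Q? N (g ∘ suc) vs)) (sym (∑-suc N _)))

  opaque
    -- The bound b on the entries is separate from the length m, so that it survives the removal of
    -- the first entry.
    total : ∀ (b : ℕ) {m} {Q : Vec ℕ m → Set} → Decidable Q → Carrier
    total b {m} Q? = listTotal Q? (tuples≤ b m)

    total-listTotal : ∀ b {m} {Q : Vec ℕ m → Set} (Q? : Decidable Q) → total b Q? ≡ listTotal Q? (tuples≤ b m)
    total-listTotal b Q? = ≡.refl

    total-suc : ∀ b {m} {Q : Vec ℕ (suc m) → Set} (Q? : Decidable Q) →
                total b Q? ≃ ∑ (suc b) (λ n → w n ⊛ total b (Q? ∘ (n ∷_)))
    total-suc b Q? = listTotal-product Q? (suc b) id (tuples≤ b _)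

    total-[] : ∀ b {Q : Vec ℕ 0 → Set} (Q? : Decidable Q) → Q [] → total b Q? ≃ 1#
    total-[] b Q? q = trans (reflexive (≡.cong (foldr _⊕_ 0# ∘ map weight) (filter-accept Q? q))) (+-identityʳ _)

    total-cong : ∀ b {m} {Q Q′ : Vec ℕ m → Set} (Q? : Decidable Q) (Q′? : Decidable Q′) →
                 (∀ v → Q v ⇔ Q′ v) → total b Q? ≃ total b Q′?
    total-cong b Q? Q′? h = reflexive (≡.cong (foldr _⊕_ 0# ∘ map weight)
      (filter-≐ Q? Q′? ((λ {v} → to (h v)) , (λ {v} → from (h v))) (tuples≤ b _)))
      where open Equivalence

    total-empty : ∀ b {m} {Q : Vec ℕ m → Set} (Q? : Decidable Q) → (∀ v → ¬ Q v) → total b Q? ≃ 0#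
    total-empty b Q? h = reflexive (≡.cong (foldr _⊕_ 0# ∘ map weight) (filter-none Q? (universal h (tuples≤ b _))))

  -- The entries of such a path have sum m - p, so a bound b ≥ m loses none of them.
  total-stay : ∀ b m p → m ≤ b → total b (Stay? p {m}) ≃ stay m p
  total-stay b zero zero    _ = total-[] b (Stay? 0) (≡.refl , λ { (s≤s z≤n) → z≤n })
  total-stay b zero (suc p) _ = total-empty b (Stay? (suc p)) (λ { [] (() , _) })
  total-stay b (suc m) zero 1+m≤b = begin
    total b (Stay? 0 {suc m})
      ≈⟨ trans (total-suc b (Stay? 0)) (∑-suc b _) ⟩
    w 0 ⊛ total b (Stay? 0 {suc m} ∘ (0 ∷_)) ⊕ ∑ b (λ n → w (suc n) ⊛ total b (Stay? 0 {suc m} ∘ (suc n ∷_)))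
      ≈⟨ +-cong (trans (*-congˡ (total-empty b _ Stay-∷-empty)) (zeroʳ _))
           (∑-cong′ b (λ n → *-congˡ (trans (total-cong b _ (Stay? n) (λ v → Stay-∷ {0} ≡.refl))
                                            (total-stay b m n (ℕ.<⇒≤ 1+m≤b))))) ⟩
    0# ⊕ ∑ b (λ n → w (suc n) ⊛ stay m n)
      ≈⟨ trans (+-identityˡ _) (∑-stay _ 1+m≤b) ⟩
    ∑ (suc m) (λ n → w (suc n) ⊛ stay m n)
      ∎
  total-stay b (suc m) (suc p) 1+m≤b = begin
    total b (Stay? (suc p) {suc m})
      ≈⟨ total-suc b (Stay? (suc p)) ⟩
    ∑ (suc b) (λ n → w n ⊛ total b (Stay? (suc p) {suc m} ∘ (n ∷_)))
      ≈⟨ ∑-cong′ (suc b) (λ n → *-congˡ (trans (total-cong b _ (Stay? (p + n)) (λ v → Stay-∷ ≡.refl))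
                                               (total-stay b m (p + n) (ℕ.<⇒≤ 1+m≤b)))) ⟩
    ∑ (suc b) (λ n → w n ⊛ stay m (p + n))
      ≈⟨ ∑-cong′ (suc b) (λ n → *-congʳ (reflexive (≡.sym (≡.trans (step-≤ (ℕ.m≤m+n p n)) (≡.cong w (ℕ.m+n∸m≡n p n)))))) ⟩
    ∑ (suc b) (λ n → step p (p + n) ⊛ stay m (p + n))
      -- A step from p + 1 cannot end below p. Adding the zero summands q < p makes the height p + n
      -- the index.
      ≈⟨ +-identityˡ _ ⟨
    0# ⊕ ∑ (suc b) (λ n → step p (p + n) ⊛ stay m (p + n))
      ≈⟨ +-congʳ (∑-zero p (λ q q<p → trans (*-congʳ (reflexive (step-> q<p))) (zeroˡ _))) ⟨
    ∑ p (λ q → step p q ⊛ stay m q) ⊕ ∑ (suc b) (λ n → step p (p + n) ⊛ stay m (p + n))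
      ≈⟨ ∑-split p (suc b) _ ⟨
    ∑ (p + suc b) (λ q → step p q ⊛ stay m q)
      ≈⟨ ∑-stay (step p) (ℕ.≤-trans (ℕ.m≤n⇒m≤1+n 1+m≤b) (ℕ.m≤n+m (suc b) p)) ⟩
    ∑ (suc m) (λ q → step p q ⊛ stay m q)
      ∎

  total-bridge-zero : ∀ b h m → h + suc m ≤ b → total b (Bridge? 0 h {suc m}) ≃ ∑ (suc m) (λ p → w (suc (h + p)) ⊛ stay m p)
  total-bridge-zero b h m h+1+m≤b = begin
    total b (Bridge? 0 h {suc m})
      ≈⟨ total-suc b (Bridge? 0 h) ⟩
    ∑ (suc b) x
      ≡⟨ ≡.cong (λ c → ∑ (suc c) x) (ℕ.m+[n∸m]≡n h≤b) ⟨
    ∑ (suc h + (b ∸ h)) x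
      -- Entries n ≤ h end below 0; the others have the form h + 1 + p and end at height p.
      ≈⟨ ∑-split (suc h) (b ∸ h) x ⟩
    ∑ (suc h) x ⊕ ∑ (b ∸ h) (λ p → x (suc h + p))
      ≈⟨ +-cong (∑-zero (suc h) (λ n n<1+h → trans (*-congˡ (total-empty b _ (Bridge-∷-zero-empty (ℕ.≤-pred n<1+h)))) (zeroʳ _)))
                (∑-cong′ (b ∸ h) (λ p → *-congˡ (trans (total-cong b _ (Stay? p) (λ v → Bridge-∷-zero))
                                                       (total-stay b m p m≤b)))) ⟩
    0# ⊕ ∑ (b ∸ h) (λ p → w (suc (h + p)) ⊛ stay m p)
      ≈⟨ trans (+-identityˡ _) (∑-stay _ (ℕ.m+n≤o⇒m≤o∸n (suc m) (ℕ.≤-trans (ℕ.≤-reflexive (ℕ.+-comm (suc m) h)) h+1+m≤b))) ⟩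
    ∑ (suc m) (λ p → w (suc (h + p)) ⊛ stay m p)
      ∎
    where
    x : ℕ → Carrier
    x n = w n ⊛ total b (Bridge? 0 h {suc m} ∘ (n ∷_))
    h≤b : h ≤ b
    h≤b = ℕ.m+n≤o⇒m≤o h h+1+m≤b
    m≤b : m ≤ b
    m≤b = ℕ.≤-trans (ℕ.n≤1+n m) (ℕ.m+n≤o⇒n≤o h h+1+m≤b)

  total-bridge-suc : ∀ b j h m → h ≤ b → total b (Bridge? (suc j) h {suc m}) ≃
                     ∑ (suc h) (λ n → w n ⊛ total b (Bridge? j (suc h ∸ n) {m}))
  total-bridge-suc b j h m h≤b = begin
    total b (Bridge? (suc j) h {suc m})
      ≈⟨ total-suc b (Bridge? (suc j) h) ⟩
    ∑ (suc b) (λ n → w n ⊛ total b (Bridge? (suc j) h {suc m} ∘ (n ∷_)))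
      ≈⟨ ∑-truncate _ (s≤s h≤b) (λ n h<n → trans (*-congˡ (total-empty b _ (Bridge-∷-suc-empty h<n))) (zeroʳ _)) ⟩
    ∑ (suc h) (λ n → w n ⊛ total b (Bridge? (suc j) h {suc m} ∘ (n ∷_)))
      ≈⟨ ∑-cong (suc h) (λ n n<1+h → *-congˡ (total-cong b _ (Bridge? j (suc h ∸ n)) (λ v → Bridge-∷-suc (ℕ.≤-pred n<1+h)))) ⟩
    ∑ (suc h) (λ n → w n ⊛ total b (Bridge? j (suc h ∸ n) {m}))
      ∎

  -- The quantity bounded by b is the sum of all entries of the path, fixed by its two ends.
  total-rise : ∀ b j p m → suc p + (j + suc m) ≤ b → total b (Bridge? j (suc p) {j + suc m}) ≃ rise j m p
  total-rise b zero    p m h = total-bridge-zero b (suc p) m h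
  total-rise b (suc j) p m h = begin
    total b (Bridge? (suc j) (suc p) {suc (j + suc m)})
      ≈⟨ total-bridge-suc b j (suc p) (j + suc m) (ℕ.m+n≤o⇒m≤o (suc p) h) ⟩
    ∑ (2 + p) (λ n → w n ⊛ total b (Bridge? j (2 + p ∸ n) {j + suc m}))
      ≈⟨ ∑-cong (2 + p) (λ n n<2+p → *-congˡ (inner n (ℕ.≤-pred n<2+p))) ⟩
    ∑ (2 + p) (λ n → w n ⊛ rise j m (suc p ∸ n))
      ∎
    where
    inner : ∀ n → n ≤ suc p → total b (Bridge? j (2 + p ∸ n) {j + suc m}) ≃ rise j m (suc p ∸ n)
    inner n n≤1+p = trans
      (reflexive (≡.cong (λ h → total b (Bridge? j h {j + suc m})) (ℕ.+-∸-assoc 1 n≤1+p)))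
      (total-rise b j (suc p ∸ n) m (ℕ.≤-trans
        (s≤s (ℕ.+-monoˡ-≤ (j + suc m) (ℕ.m∸n≤m (suc p) n)))
        (ℕ.≤-trans (ℕ.≤-reflexive (≡.cong suc (≡.sym (ℕ.+-suc p (j + suc m))))) h)))

  total-positive : ∀ m → total (suc m) (Bridge? 0 0 {suc m}) ≃ stay (suc m) 0
  total-positive m = total-bridge-zero (suc m) 0 m ℕ.≤-refl

  total-bridge : ∀ j m → total (suc (j + suc m)) (Bridge? (suc j) 0 {suc (j + suc m)}) ≃ bridge j m
  total-bridge j m = begin
    total b (Bridge? (suc j) 0 {b})                 ≈⟨ total-bridge-suc b j 0 (j + suc m) z≤n ⟩
    ∑ 1 (λ n → w n ⊛ total b (Bridge? j (1 ∸ n)))   ≈⟨ ∑-one _ ⟩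
    w 0 ⊛ total b (Bridge? j 1 {j + suc m})         ≈⟨ *-congˡ (total-rise b j 0 m ℕ.≤-refl) ⟩
    w 0 ⊛ rise j m 0                                ≈⟨ *-congˡ (rise-hankel j m) ⟩
    bridge j m                                      ∎
    where
    b : ℕ
    b = suc (j + suc m)

-- The commutative semiring of polynomials.

+ᴾ-assoc : ∀ p q s → (p +ᴾ q) +ᴾ s ≈ p +ᴾ (q +ᴾ s)
+ᴾ-assoc p q s = mk≈ λ n → begin
  coeff ((p +ᴾ q) +ᴾ s) n                       ≡⟨ ≡.trans (coeff-+ (p +ᴾ q) s n) (≡.cong (ℚ._+ coeff s n) (coeff-+ p q n)) ⟩
  (coeff p n ℚ.+ coeff q n) ℚ.+ coeff s n       ≡⟨ ℚ.+-assoc (coeff p n) _ _ ⟩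
  coeff p n ℚ.+ (coeff q n ℚ.+ coeff s n)       ≡⟨ ≡.trans (coeff-+ p (q +ᴾ s) n) (≡.cong (coeff p n ℚ.+_) (coeff-+ q s n)) ⟨
  coeff (p +ᴾ (q +ᴾ s)) n                       ∎
  where open ≡.≡-Reasoning

+ᴾ-comm : ∀ p q → p +ᴾ q ≈ q +ᴾ p
+ᴾ-comm p q = mk≈ λ n →
  ≡.trans (coeff-+ p q n) (≡.trans (ℚ.+-comm (coeff p n) _) (≡.sym (coeff-+ q p n)))

≈-setoid : Setoid 0ℓ 0ℓ
≈-setoid = record
  { Carrier = Poly
  ; _≈_     = _≈_
  ; isEquivalence = record { refl = ≈-refl ; sym = ≈-sym ; trans = ≈-trans }
  }

+ᴾ-isCommutativeMonoid : IsCommutativeMonoid _≈_ _+ᴾ_ 0ᴾ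
+ᴾ-isCommutativeMonoid = record
  { isMonoid = record
    { isSemigroup = record
      { isMagma = record
        { isEquivalence = Setoid.isEquivalence ≈-setoid
        ; ∙-cong        = +ᴾ-cong
        }
      ; assoc = +ᴾ-assoc
      }
    ; identity = (λ _ → ≈-refl) , +ᴾ-identityʳ
    }
  ; comm = +ᴾ-comm
  }

+ᴾ-commutativeMonoid : CommutativeMonoid 0ℓ 0ℓ
+ᴾ-commutativeMonoid = record { isCommutativeMonoid = +ᴾ-isCommutativeMonoid }

open CommutativeSemigroupProperties (CommutativeMonoid.commutativeSemigroup +ᴾ-commutativeMonoid)
  using (interchange) renaming (x∙yz≈y∙xz to p+[q+s]≈q+[p+s])

·-distribˡ-+ᴾ : ∀ c p q → c · (p +ᴾ q) ≈ c · p +ᴾ c · q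
·-distribˡ-+ᴾ c p q = mk≈ λ n → begin
  coeff (c · (p +ᴾ q)) n                     ≡⟨ ≡.trans (coeff-· c (p +ᴾ q) n) (≡.cong (c ℚ.*_) (coeff-+ p q n)) ⟩
  c ℚ.* (coeff p n ℚ.+ coeff q n)            ≡⟨ ℚ.*-distribˡ-+ c _ _ ⟩
  c ℚ.* coeff p n ℚ.+ c ℚ.* coeff q n        ≡⟨ ≡.cong₂ ℚ._+_ (coeff-· c p n) (coeff-· c q n) ⟨
  coeff (c · p) n ℚ.+ coeff (c · q) n        ≡⟨ coeff-+ (c · p) (c · q) n ⟨
  coeff (c · p +ᴾ c · q) n                   ∎
  where open ≡.≡-Reasoning

·-distribʳ-+ : ∀ p c d → (c ℚ.+ d) · p ≈ c · p +ᴾ d · p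
·-distribʳ-+ p c d = mk≈ λ n → begin
  coeff ((c ℚ.+ d) · p) n                    ≡⟨ coeff-· (c ℚ.+ d) p n ⟩
  (c ℚ.+ d) ℚ.* coeff p n                    ≡⟨ ℚ.*-distribʳ-+ (coeff p n) c d ⟩
  c ℚ.* coeff p n ℚ.+ d ℚ.* coeff p n        ≡⟨ ≡.cong₂ ℚ._+_ (coeff-· c p n) (coeff-· d p n) ⟨
  coeff (c · p) n ℚ.+ coeff (d · p) n        ≡⟨ coeff-+ (c · p) (d · p) n ⟨
  coeff (c · p +ᴾ d · p) n                   ∎
  where open ≡.≡-Reasoning

·-assoc : ∀ c d p → (c ℚ.* d) · p ≈ c · d · p
·-assoc c d p = mk≈ λ n → begin
  coeff ((c ℚ.* d) · p) n        ≡⟨ coeff-· (c ℚ.* d) p n ⟩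
  (c ℚ.* d) ℚ.* coeff p n        ≡⟨ ℚ.*-assoc c d _ ⟩
  c ℚ.* (d ℚ.* coeff p n)        ≡⟨ ≡.cong (c ℚ.*_) (coeff-· d p n) ⟨
  c ℚ.* coeff (d · p) n          ≡⟨ coeff-· c (d · p) n ⟨
  coeff (c · d · p) n            ∎
  where open ≡.≡-Reasoning

·-identityˡ : ∀ p → 1ℚ · p ≈ p
·-identityˡ p = mk≈ λ n → ≡.trans (coeff-· 1ℚ p n) (ℚ.*-identityˡ _)

·-zeroˡ : ∀ p → 0ℚ · p ≈ 0ᴾ
·-zeroˡ p = mk≈ λ n → ≡.trans (coeff-· 0ℚ p n) (ℚ.*-zeroˡ (coeff p n))

·-*ᴾ-assoc : ∀ c p q → (c · p) *ᴾ q ≈ c · (p *ᴾ q)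
·-*ᴾ-assoc c []      q = ≈-refl
·-*ᴾ-assoc c (d ∷ p) q = ≈-trans
  (+ᴾ-cong (·-assoc c d q) (∷-cong (≡.sym (ℚ.*-zeroʳ c)) (·-*ᴾ-assoc c p q)))
  (≈-sym (·-distribˡ-+ᴾ c (d · q) (0ℚ ∷ p *ᴾ q)))

0∷-*ᴾ : ∀ p q → (0ℚ ∷ p) *ᴾ q ≈ 0ℚ ∷ p *ᴾ q
0∷-*ᴾ p q = +ᴾ-cong {q = 0ℚ ∷ p *ᴾ q} (·-zeroˡ q) ≈-refl

0∷-+ᴾ : ∀ p q → 0ℚ ∷ (p +ᴾ q) ≈ (0ℚ ∷ p) +ᴾ (0ℚ ∷ q)
0∷-+ᴾ p q = ∷-cong (≡.sym (ℚ.+-identityˡ 0ℚ)) ≈-refl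

*ᴾ-distribʳ : ∀ s p q → (p +ᴾ q) *ᴾ s ≈ p *ᴾ s +ᴾ q *ᴾ s
*ᴾ-distribʳ s []      q       = ≈-refl
*ᴾ-distribʳ s (c ∷ p) []      = ≈-sym (+ᴾ-identityʳ _)
*ᴾ-distribʳ s (c ∷ p) (d ∷ q) = ≈-trans
  (+ᴾ-cong (·-distribʳ-+ s c d)
           (≈-trans (∷-cong ≡.refl (*ᴾ-distribʳ s p q)) (0∷-+ᴾ (p *ᴾ s) (q *ᴾ s))))
  (interchange (c · s) (d · s) (0ℚ ∷ p *ᴾ s) (0ℚ ∷ q *ᴾ s))

*ᴾ-assoc : ∀ p q s → (p *ᴾ q) *ᴾ s ≈ p *ᴾ (q *ᴾ s)
*ᴾ-assoc []      q s = ≈-refl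
*ᴾ-assoc (c ∷ p) q s = ≈-trans (*ᴾ-distribʳ s (c · q) (0ℚ ∷ p *ᴾ q))
  (+ᴾ-cong (·-*ᴾ-assoc c q s) (≈-trans (0∷-*ᴾ (p *ᴾ q) s) (∷-cong ≡.refl (*ᴾ-assoc p q s))))

*ᴾ-∷ʳ : ∀ p d q → p *ᴾ (d ∷ q) ≈ d · p +ᴾ (0ℚ ∷ p *ᴾ q)
*ᴾ-∷ʳ []      d q = mk≈ λ { zero → ≡.refl ; (suc n) → ≡.refl }
*ᴾ-∷ʳ (c ∷ p) d q = ∷-cong (≡.cong (ℚ._+ 0ℚ) (ℚ.*-comm c d))
  (≈-trans (+ᴾ-cong (≈-refl {c · q}) (*ᴾ-∷ʳ p d q)) (p+[q+s]≈q+[p+s] (c · q) (d · p) (0ℚ ∷ p *ᴾ q)))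

*ᴾ-comm : ∀ p q → p *ᴾ q ≈ q *ᴾ p
*ᴾ-comm []      q = ≈-sym (*ᴾ-zeroʳ q)
*ᴾ-comm (c ∷ p) q = ≈-trans
  (+ᴾ-cong (≈-refl {c · q}) (∷-cong ≡.refl (*ᴾ-comm p q))) (≈-sym (*ᴾ-∷ʳ q c p))

*ᴾ-isCommutativeMonoid : IsCommutativeMonoid _≈_ _*ᴾ_ 1ᴾ
*ᴾ-isCommutativeMonoid = record
  { isMonoid = record
    { isSemigroup = record
      { isMagma = record
        { isEquivalence = Setoid.isEquivalence ≈-setoid
        ; ∙-cong        = λ {p} {p′} {q} {q′} h k → ≈-trans (*ᴾ-congʳ q h) (*ᴾ-congˡ p′ k)
        }
      ; assoc = *ᴾ-assoc
      }
    ; identity = (λ p → ≈-trans (*ᴾ-comm 1ᴾ p) (*ᴾ-identityʳ p)) , *ᴾ-identityʳ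
    }
  ; comm = *ᴾ-comm
  }

ℚ[a] : CommutativeSemiring 0ℓ 0ℓ
ℚ[a] = record
  { isCommutativeSemiring = isCommutativeSemiringˡ (record
    { +-isCommutativeMonoid = +ᴾ-isCommutativeMonoid
    ; *-isCommutativeMonoid = *ᴾ-isCommutativeMonoid
    ; distribʳ              = *ᴾ-distribʳ
    ; zeroˡ                 = λ _ → ≈-refl
    })
  }

p+t≈q⇒p≈q-t : ∀ p q t → p +ᴾ t ≈ q → p ≈ q -ᴾ t
p+t≈q⇒p≈q-t p q t h = begin
  p                              ≈⟨ +ᴾ-identityʳ p ⟨
  p +ᴾ 0ᴾ                        ≈⟨ +ᴾ-cong (≈-refl {p}) (+ᴾ-cancel-ᴾ t 0ᴾ) ⟨
  p +ᴾ (t +ᴾ (ℚ.- 1ℚ) · t)       ≈⟨ +ᴾ-assoc p t _ ⟨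
  p +ᴾ t -ᴾ t                    ≈⟨ +ᴾ-cong h (≈-refl {(ℚ.- 1ℚ) · t}) ⟩
  q -ᴾ t                         ∎
  where open SetoidReasoning ≈-setoid

-- The coefficients `C` as path sums.

normalized : ℕ → Poly
normalized n = 1/ n ! · bernoulli n

-- The factor (-1)^r of C i r, distributed over the r steps.
signed : ℕ → Poly
signed n = (ℚ.- 1ℚ) · normalized n

open PathSums ℚ[a] signed

signed-product : ∀ ns → (ℚ.- 1ℚ) ^ length ns · prodᴾ (map normalized ns) ≈ prodᴾ (map signed ns)
signed-product []       = ·-identityˡ 1ᴾ
signed-product (n ∷ ns) = begin
  (ε ℚ.* c) · (x *ᴾ y)           ≈⟨ ·-assoc ε c _ ⟩
  ε · c · (x *ᴾ y)               ≈⟨ ·-cong ε (·-cong c (*ᴾ-comm x y)) ⟩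
  ε · c · (y *ᴾ x)               ≈⟨ ·-cong ε (·-*ᴾ-assoc c y x) ⟨
  ε · ((c · y) *ᴾ x)             ≈⟨ ·-cong ε (*ᴾ-comm (c · y) x) ⟩
  ε · (x *ᴾ (c · y))             ≈⟨ ·-*ᴾ-assoc ε x (c · y) ⟨
  (ε · x) *ᴾ (c · y)             ≈⟨ *ᴾ-congˡ (ε · x) (signed-product ns) ⟩
  (ε · x) *ᴾ prodᴾ (map signed ns) ∎
  where
  open SetoidReasoning ≈-setoid
  ε c : ℚ
  ε = ℚ.- 1ℚ
  c = ε ^ length ns
  x y : Poly
  x = normalized n
  y = prodᴾ (map normalized ns)

signed-sum : ∀ {r} (vs : List (Vec ℕ r)) →
  (ℚ.- 1ℚ) ^ r · sumᴾ (map (λ v → prodᴾ (map normalized (toList v))) vs) ≈ sumᴾ (map weight vs)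
signed-sum     []       = ≈-refl
signed-sum {r} (v ∷ vs) = ≈-trans
  (·-distribˡ-+ᴾ ((ℚ.- 1ℚ) ^ r) (product v) (sumᴾ (map product vs)))
  (+ᴾ-cong head (signed-sum vs))
  where
  product : Vec ℕ r → Poly
  product u = prodᴾ (map normalized (toList u))

  head : (ℚ.- 1ℚ) ^ r · product v ≈ weight v
  head = ≡.subst (λ m → (ℚ.- 1ℚ) ^ m · product v ≈ weight v)
                 (length-toList v) (signed-product (toList v))

C≈total : ∀ j r → C (suc j) r ≈ total r (Bridge? j 0 {r})
C≈total j r = ≈-trans (signed-sum (S (suc j) r)) (CommutativeSemiring.reflexive ℚ[a] (≡.trans
  -- `Bridge j 0` unfolds to `InS (suc j) r`, so both inclusions are identities.
  (≡.cong (sumᴾ ∘ map weight) (filter-≐ (InS? (suc j) r) (Bridge? j 0) (id , id) (tuples≤ r r)))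
  (≡.sym (total-listTotal r (Bridge? j 0)))))

C-one : ∀ m → C 1 (suc m) ≈ stay (suc m) 0
C-one m = ≈-trans (C≈total 0 (suc m)) (total-positive m)

C-bridge : ∀ j m → C (2 + j) (2 + (j + m)) ≈ bridge j m
C-bridge j m = ≡.subst (λ r → C (2 + j) (suc r) ≈ bridge j m) (ℕ.+-suc j m)
  (≈-trans (C≈total (suc j) _) (total-bridge j m))

-- For m ≥ 1 these paths are negative until their last step. `bridge-sym` exchanges them with the
-- bridges that are negative only after the first step.
C-prime : ∀ m → C (suc m) (suc m) ≈ prime m
C-prime zero    = ≈-trans (C-one 0) (≈-trans (∑-one _) (*ᴾ-identityʳ (signed 1)))
C-prime (suc j) = ≡.subst (λ k → C (2 + j) (2 + k) ≈ prime (suc j)) (ℕ.+-identityʳ j)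
  (≈-trans (C-bridge j 0) (≈-trans (bridge-sym j 0) (bridge-zero j)))

-- The recursion for `C`.

sumᴾ-applyUpTo : ∀ n f → sumᴾ (applyUpTo f n) ≈ ∑ n f
sumᴾ-applyUpTo zero    f = ≈-sym (∑-empty f)
sumᴾ-applyUpTo (suc n) f = ≈-trans (+ᴾ-cong (≈-refl {f 0}) (sumᴾ-applyUpTo n (f ∘ suc))) (≈-sym (∑-suc n f))

-- With k = i + t one has r - k = (m - t) + 1, so the diagonal factor is `prime (m ∸ t)`. Equations
-- for n and r allow j + m to be used in either order.
∑-C-prime : ∀ {n r} i m (x : ℕ → Poly) → n ≡ i + m → r ≡ suc (i + m) → (∀ t → C i (i + t) ≈ x t) →
  ∑[ i ⋯ n ] (λ k → C i k *ᴾ C (r ∸ k) (r ∸ k)) ≈ ∑ (suc m) (λ t → x t *ᴾ prime (m ∸ t))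
∑-C-prime {n} {r} i m x ≡.refl ≡.refl h = ≈-trans
  (sumᴾ-applyUpTo (suc (i + m) ∸ i) _)
  (≈-trans (CommutativeSemiring.reflexive ℚ[a] (≡.cong (λ l → ∑ l summand) r∸i≡1+m))
           (∑-cong (suc m) term))
  where
  summand : ℕ → Poly
  summand t = C i (i + t) *ᴾ C (r ∸ (i + t)) (r ∸ (i + t))

  r∸i≡1+m : suc (i + m) ∸ i ≡ suc m
  r∸i≡1+m = ≡.trans (≡.cong (_∸ i) (≡.sym (ℕ.+-suc i m))) (ℕ.m+n∸m≡n i (suc m))

  term : ∀ t → t < suc m → summand t ≈ x t *ᴾ prime (m ∸ t)
  term t t<1+m = ≈-trans (*ᴾ-congʳ _ (h t)) (*ᴾ-congˡ (x t)
    (≡.subst (λ k → C k k ≈ prime (m ∸ t)) (≡.sym r∸[i+t]≡1+[m∸t]) (C-prime (m ∸ t))))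
    where
    r∸[i+t]≡1+[m∸t] : suc (i + m) ∸ (i + t) ≡ suc (m ∸ t)
    r∸[i+t]≡1+[m∸t] = ≡.trans (≡.sym (ℕ.∸-+-assoc (suc (i + m)) i t))
      (≡.trans (≡.cong (_∸ t) r∸i≡1+m) (ℕ.+-∸-assoc 1 (ℕ.≤-pred t<1+m)))

C-recursion-one : ∀ m → C 2 (2 + m) +ᴾ ∑[ 1 ⋯ suc m ] (λ k → C 1 k *ᴾ C (2 + m ∸ k) (2 + m ∸ k)) ≈ C 1 (2 + m)
C-recursion-one m = begin
  C 2 (2 + m) +ᴾ ∑[ 1 ⋯ suc m ] (λ k → C 1 k *ᴾ C (2 + m ∸ k) (2 + m ∸ k))
    ≈⟨ +ᴾ-cong (≈-trans (C-bridge 0 m) (bridge-zero m))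
               (∑-C-prime 1 m (λ t → stay (suc t) 0) ≡.refl ≡.refl C-one) ⟩
  prime (suc m) +ᴾ ∑ (suc m) (λ t → stay (suc t) 0 *ᴾ prime (m ∸ t))
    ≈⟨ stay-zero-decomposition (suc m) ⟨
  stay (2 + m) 0
    ≈⟨ C-one (suc m) ⟨
  C 1 (2 + m)
    ∎
  where open SetoidReasoning ≈-setoid

-- For i = 2 + j the index r - i + 1 is 2 + m, and this is the claim with the subtracted sum moved
-- to the left.
C-recursion : ∀ j m → let r = 3 + (j + m) in
  C (3 + j) r +ᴾ ∑[ 2 + j ⋯ r ∸ 1 ] (λ k → C (2 + j) k *ᴾ C (r ∸ k) (r ∸ k)) ≈
  C (2 + j) r +ᴾ ∑[ 2 + m ⋯ r ∸ 1 ] (λ k → C (2 + m) k *ᴾ C (r ∸ k) (r ∸ k))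
C-recursion j m = begin
  C (3 + j) r +ᴾ ∑[ 2 + j ⋯ r ∸ 1 ] (λ k → C (2 + j) k *ᴾ C (r ∸ k) (r ∸ k))
    ≈⟨ +ᴾ-cong (C-bridge (suc j) m) (∑-C-prime (2 + j) m (bridge j) ≡.refl ≡.refl (C-bridge j)) ⟩
  bridge (suc j) m +ᴾ ∑ (suc m) (λ t → bridge j t *ᴾ prime (m ∸ t))
    ≈⟨ bridge-exchange j m ⟩
  bridge j (suc m) +ᴾ ∑ (suc j) (λ t → bridge m t *ᴾ prime (j ∸ t))
    ≈⟨ +ᴾ-cong (≡.subst (λ r → C (2 + j) (2 + r) ≈ bridge j (suc m)) (ℕ.+-suc j m) (C-bridge j (suc m)))
               (∑-C-prime (2 + m) j (bridge m) (≡.cong (2 +_) (ℕ.+-comm j m)) (≡.cong (3 +_) (ℕ.+-comm j m)) (C-bridge m)) ⟨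
  C (2 + j) r +ᴾ ∑[ 2 + m ⋯ r ∸ 1 ] (λ k → C (2 + m) k *ᴾ C (r ∸ k) (r ∸ k))
    ∎
  where
  open SetoidReasoning ≈-setoid
  r : ℕ
  r = 3 + (j + m)

theorem6p1 : ∀ (i r : ℕ) → 1 ≤ i → i < r →
    C (i + 1) r ≈ C i r
    +ᴾ ∑[ r ∸ i + 1 ⋯ r ∸ 1 ] (λ k → C (r ∸ i + 1) k *ᴾ C (r ∸ k) (r ∸ k))
    -ᴾ ∑[ i ⋯ r ∸ 1 ] (λ k → C i k *ᴾ C (r ∸ k) (r ∸ k))
theorem6p1 (suc zero) (suc zero) _ (s≤s ())
theorem6p1 (suc zero) (suc (suc m)) _ _ = p+t≈q⇒p≈q-t _ _ _
  (≈-trans (C-recursion-one m) (≈-trans (≈-sym (+ᴾ-identityʳ _)) (+ᴾ-cong (≈-refl {C 1 (2 + m)}) (≈-sym empty))))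
  where
  summand : ℕ → Poly
  summand k = C (suc m + 1) k *ᴾ C (2 + m ∸ k) (2 + m ∸ k)

  -- For i = 1 the added sum runs from r to r - 1.
  empty : ∑[ suc m + 1 ⋯ suc m ] summand ≈ 0ᴾ
  empty = CommutativeSemiring.reflexive ℚ[a]
    (≡.cong (λ n → sumᴾ (applyUpTo (λ j → summand (suc m + 1 + j)) n)) (≡.trans (≡.cong (λ n → suc m ∸ n) (ℕ.+-comm m 1)) (ℕ.n∸n≡0 (suc m))))
theorem6p1 (suc (suc j)) (suc (suc (suc r))) _ (s≤s (s≤s (s≤s j≤r))) with ℕ.m≤n⇒∃[o]m+o≡n j≤r
-- Here m = r - i - 1 for the original r and i = 2 + j.
... | m , ≡.refl = p+t≈q⇒p≈q-t _ _ _
  (≡.subst₂ (λ i i′ → C i (3 + (j + m)) +ᴾ ∑[ 2 + j ⋯ 2 + (j + m) ] (summand (2 + j)) ≈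
                      C (2 + j) (3 + (j + m)) +ᴾ ∑[ i′ ⋯ 2 + (j + m) ] (summand i′))
            (≡.cong (2 +_) (ℕ.+-comm 1 j)) (≡.sym r∸i+1≡2+m) (C-recursion j m))
  where
  summand : ℕ → ℕ → Poly
  summand i k = C i k *ᴾ C (3 + (j + m) ∸ k) (3 + (j + m) ∸ k)

  r∸i+1≡2+m : suc (j + m) ∸ j + 1 ≡ 2 + m
  r∸i+1≡2+m = ≡.trans (≡.cong (λ n → n ∸ j + 1) (≡.sym (ℕ.+-suc j m)))
    (≡.trans (≡.cong (_+ 1) (ℕ.m+n∸m≡n j (suc m))) (ℕ.+-comm (suc m) 1))
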